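{- Let $k\ge2$ and let $f\colon\mathbb{N}_0\to\{0,1\}$ be a sparse $k$-automatic sequence. Then either $f$ is very sparse (in base $k$), or there exists an IPS-set $E$ such that $f(n)=1$ for all $n\in E$.
   Context: $\mathbb{N}=\{1,2,\dots\}$, $\mathbb{N}_0=\{0,1,2,\dots\}$. The upper Banach density of $E\subset\mathbb{N}_0$ is $\limsup_{N\to\infty}\max_M|E\cap[M,M+N)|/N$; a sequence $f\colon\mathbb{N}_0\to\{0,1\}$ is sparse if it is the characteristic function of a set of upper Banach density $0$. For $k\ge2$ let $\Sigma_k=\{0,\dots,k-1\}$, let $\Sigma_k^*$ be the set of finite words over $\Sigma_k$ (including the empty word); for $w\in\Sigma_k^*$ let $[w]_k$ be the integer whose base-$k$ expansion is $w$ (leading zeros allowed, most significant digit first), and for $n\ge0$ let $(n)_k$ be the base-$k$ representation of $n$ without leading zeros ($(0)_k$ is the empty word). A $k$-automaton $(S,s_\bullet,\delta,\Omega,\tau)$ consists of a finite set of states $S$, an initial state $s_\bullet\in S$, a transition map $\delta\colon S\times\Sigma_k\to S$ (extended to $\tilde\delta\colon S\times\Sigma_k^*\to S$ by reading a word letter by letter from left to right), an output set $\Omega$ and an output map $\tau\colon S\to\Omega$. A sequence $(a_n)_{n\ge0}$ with values in a finite set $\Omega$ is $k$-automatic if there is a $k$-automaton with $a_n=\tau(\tilde\delta(s_\bullet,(n)_k))$ for all $n$. A basic very sparse set of rank $r\ge0$, base $k$, is a set of the form $\{[w_0u_1^{l_1}w_1u_2^{l_2}\cdots u_r^{l_r}w_r]_k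 : l_1,\dots,l_r\in\mathbb{N}_0\}$ with $u_1,\dots,u_r,w_0,\dots,w_r\in\Sigma_k^*$. A very sparse set (of rank $r$, base $k$) is a finite union of basic very sparse sets (of rank $r$, base $k$). A sequence $f\colon\mathbb{N}_0\to\{0,1\}$ is very sparse if $\{n: f(n)=1\}$ is very sparse. For a sequence $(n_i)_{i\in\mathbb{N}}\subset\mathbb{N}$ and shifts $(N_t)_{t\ge1}\subset\mathbb{N}_0$ put $\mathrm{FS}(n_i;N_t)=\{n_\alpha+N_t : t\in\mathbb{N},\ \alpha\subset\{1,\dots,t\}\}$, where $n_\alpha=\sum_{i\in\alpha}n_i$. Any set containing $\mathrm{FS}(n_i;N_t)$ for some $(n_i),(N_t)$ is called an IPS-set. -}

module Defs where

open import Data.Bool.Base using (if_then_else_)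
open import Data.Fin.Base using (Fin; toℕ)
open import Data.Fin.Patterns using (1F)
import Data.Fin.Properties as Fin
open import Data.Fin.Subset using (Subset)
open import Data.Integer.Base as ℤ using ()
open import Data.List.Base
  using (List; []; _∷_; _++_; _∷ʳ_; foldl; concat; replicate; applyUpTo; length; filter)
open import Data.List.Relation.Unary.Any using (Any)
open import Data.Nat.Base
open import Data.Nat.DivMod using (_mod_; m/n<m)
open import Data.Nat.Induction using (Acc; acc; <-wellFounded)
open import Data.Product.Base using (∃; ∃-syntax; Σ-syntax; _×_; _,_)
open import Data.Rational.Base as ℚ using (ℚ; 0ℚ)
open import Data.Vec.Base as Vec using (Vec; []; _∷_; zipWith; tabulate)
open import Function.Bundles using (_↔_)
open import Level using (0ℓ)
open import Relation.Binary.PropositionalEquality using (_≡_)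
open import Relation.Unary using (Pred; Decidable; _∈_; _⊆_; _≐_)

Finite : Set → Set
Finite A = ∃[ n ] (A ↔ Fin n)

Support : (ℕ → Fin 2) → Pred ℕ 0ℓ
Support f n = f n ≡ 1F

support? : (f : ℕ → Fin 2) → Decidable (Support f)
support? f n = f n Fin.≟ 1F

------------------------------------------------------------------------
-- Upper Banach density

-- |E ∩ [M, M + N)|
count : {E : Pred ℕ 0ℓ} → Decidable E → (M N : ℕ) → ℕ
count E? M N = length (filter E? (applyUpTo (M +_) N))

freq : {E : Pred ℕ 0ℓ} → Decidable E → (M N : ℕ) .{{_ : NonZero N}} → ℚ
freq E? M N = (ℤ.+ count E? M N) ℚ./ N

-- limsup_{N → ∞} max_M |E ∩ [M, M + N)| / N = d, as the two ε-conditions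
-- characterising a limsup: eventually max_M … < d + ε, and d - ε < max_M …
-- for arbitrarily large N.  For a fixed N the maximum over M is below a bound
-- iff every M is, and above a bound iff some M is.
HasUpperBanachDensity : {E : Pred ℕ 0ℓ} → Decidable E → ℚ → Set
HasUpperBanachDensity E? d = (ε : ℚ) → 0ℚ ℚ.< ε →
  (∃[ N₀ ] (∀ N .{{_ : NonZero N}} → N₀ ≤ N → ∀ M → freq E? M N ℚ.< d ℚ.+ ε)) ×
  (∀ N₀ → ∃[ N ] Σ[ N≢0 ∈ NonZero N ] N₀ ≤ N ×
     ∃[ M ] d ℚ.- ε ℚ.< freq E? M N {{N≢0}})

Sparse : (ℕ → Fin 2) → Set
Sparse f = HasUpperBanachDensity (support? f) 0ℚ

------------------------------------------------------------------------
-- Words, automata and very sparse sets in base k ≥ 2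

Word : ℕ → Set
Word k = List (Fin k)

_^ʷ_ : ∀ {k} → Word k → ℕ → Word k
u ^ʷ l = concat (replicate l u)

module _ (k : ℕ) where

  -- The most significant digit comes first.
  value : Word k → ℕ
  value = foldl (λ m d → m * k + toℕ d) 0

  record Automaton (Ω : Set) : Set₁ where
    field
      State        : Set
      state-finite : Finite State
      start        : State
      δ            : State → Fin k → State
      Ω-finite     : Finite Ω
      τ            : State → Ω

    δ̃ : State → Word k → State
    δ̃ = foldl δ

  module _ .{{_ : NonTrivial k}} where

    private instance
      k≢0 : NonZero k
      k≢0 = nonTrivial⇒nonZero k

    digits′ : ∀ n → Acc _<_ n → Word k
    digits′ zero      _         = []
    digits′ n@(suc _) (acc rec) =
      digits′ (n / k) (rec (m/n<m n k (nonTrivial⇒n>1 k))) ∷ʳ (n mod k)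

    -- The expansion of n without leading zeros; that of 0 is the empty word.
    digits : ℕ → Word k
    digits n = digits′ n (<-wellFounded n)

    Automatic : {Ω : Set} → (ℕ → Ω) → Set₁
    Automatic {Ω} a = Σ[ A ∈ Automaton Ω ]
      (let open Automaton A in ∀ n → a n ≡ τ (δ̃ start (digits n)))

  -- w₀ u₁^l₁ w₁ ⋯ u_r^l_r w_r, given w₀, the pairs (u_i , w_i) and the l_i.
  pumped : ∀ {r} → Word k → Vec (Word k × Word k) r → Vec ℕ r → Word k
  pumped w₀ []             []       = w₀
  pumped w₀ ((u , w) ∷ uw) (l ∷ ls) = w₀ ++ (u ^ʷ l) ++ pumped w uw ls

  BasicData : ℕ → Set
  BasicData r = Word k × Vec (Word k × Word k) r

  BasicVerySparse : ∀ {r} → BasicData r → Pred ℕ 0ℓ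
  BasicVerySparse {r} (w₀ , uw) n = ∃[ ls ] n ≡ value (pumped w₀ uw ls)

  VerySparseSet : (r : ℕ) → Pred ℕ 0ℓ → Set
  VerySparseSet r E = Σ[ bs ∈ List (BasicData r) ]
    E ≐ (λ n → Any (λ b → n ∈ BasicVerySparse b) bs)

  VerySparse : (ℕ → Fin 2) → Set
  VerySparse f = ∃[ r ] VerySparseSet r (Support f)

------------------------------------------------------------------------
-- IPS-sets

-- The sequences (n_i) and (N_t) are indexed by {1, 2, …}: their values at 0
-- play no role.  Position i : Fin t of a subset α stands for the element
-- 1 + i of {1, …, t}.

-- n_α
sumOver : (ℕ → ℕ) → ∀ {t} → Subset t → ℕ
sumOver n α =
  Vec.sum (zipWith (λ i∈α nᵢ → if i∈α then nᵢ else 0) α (tabulate (λ i → n (suc (toℕ i)))))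

FS : (n N : ℕ → ℕ) → Pred ℕ 0ℓ
FS n N m = ∃[ t ] 1 ≤ t × Σ[ α ∈ Subset t ] m ≡ sumOver n α + N t

IPS : Pred ℕ 0ℓ → Set
IPS E = Σ[ n ∈ (ℕ → ℕ) ] Σ[ N ∈ (ℕ → ℕ) ] (∀ i → 1 ≤ i → 1 ≤ n i) × FS n N ⊆ E

-- If an accessible state s, from which acceptance is possible, admits two
-- loops u and v with different first letters, then uv and vu are loops of the
-- same length and different values.  Reading them in arbitrary order between
-- a prefix leading to s and an accepting suffix yields an IPS-set, n_i being
-- the difference of the values of vu and uv, scaled by the position of the
-- block.  Otherwise every loop at such a state is a power of one word, and
-- splitting an accepted run after its last visit to each successive state
-- shows that the accepted words have the form w₀ u₁^l₁ w₁ ⋯ u_r^l_r w_r, with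
-- r the number of states.

module Submission where

open import Defs
open import Data.Bool.Base using (true; false; if_then_else_)
open import Data.Fin.Base using (Fin; toℕ; _<_)
open import Data.Fin.Patterns using (1F)
import Data.Fin.Properties as Fin
open import Data.Fin.Subset using (Subset; ∣_∣; ⊤; ⊥; _-_) renaming (_∈_ to _∈ˢ_)
open import Data.Fin.Subset.Properties using (∈⊤; ∣⊤∣≡n; x∈p∧x≢y⇒x∈p-y; x∈p⇒∣p-x∣<∣p∣)
open import Data.List.Base
  using (List; []; _∷_; _++_; _∷ʳ_; foldl; length; map; concatMap; allFin; filter)
open import Data.List.Membership.Propositional using (lose; find) renaming (_∈_ to _∈ˡ_)
open import Data.List.Membership.Propositional.Properties using (∈-allFin; ∈-filter⁺; ∈-filter⁻)
open import Data.List.Properties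
  using (foldl-++; length-++; length-++-comm; length-++-≤ʳ; ++-assoc)
open import Data.List.Relation.Unary.Any as Any using (Any; here)
open import Data.List.Relation.Unary.Any.Properties
  using (map⁺; map⁻; ++⁺ˡ; ++⁺ʳ; ++⁻; concatMap⁺; concatMap⁻)
open import Data.List.Reverse using (Reverse; []; _∶_∶ʳ_; reverseView)
open import Data.Nat.Base as ℕ
  using (ℕ; zero; suc; _+_; _*_; _^_; _∸_; _≤_; z≤n; s≤s; NonTrivial; NonZero; nonTrivial⇒nonZero)
open import Data.Nat.DivMod
  using (_/_; _%_; _mod_; m%n<n; m<n⇒m%n≡m; m≡m%n+[m/n]*n; [m+kn]%n≡m%n)
open import Data.Nat.Induction using (Acc; acc; <-wellFounded)
open import Data.Nat.Properties as ℕ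
  using (+-comm; +-identityʳ; *-identityʳ; +-cancelˡ-≡; *-cancelʳ-≡; +-monoʳ-<; *-monoˡ-≤;
         *-mono-≤; m≤m+n; m∸n+n≡m; m<n⇒0<n∸m; m+n≡0⇒m≡0; m*n≡0⇒m≡0∨n≡0; m^n>0; >⇒≢; <⇒≤;
         ≤-trans; ≤-reflexive; suc-injective; module ≤-Reasoning)
open import Data.Nat.Tactic.RingSolver using (solve-∀)
open import Data.Product.Base using (Σ-syntax; ∃; ∃-syntax; _×_; _,_; proj₁; proj₂; map₂)
open import Data.Sum.Base using (_⊎_; inj₁; inj₂)
open import Data.Vec.Base as Vec using (Vec; []; _∷_)
open import Function.Base using (_∘_; id; case_of_)
open import Function.Bundles using (module Inverse)
open import Level using (0ℓ)
open import Relation.Binary.Definitions using (tri<; tri≈; tri>)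
open import Relation.Binary.PropositionalEquality
  using (_≡_; _≢_; refl; sym; trans; cong; cong₂; subst; module ≡-Reasoning)
open import Relation.Nullary using (¬_; Dec; yes; no; contradiction; ¬?)
open import Relation.Nullary.Decidable using (map′; _×-dec_; _⊎-dec_)
open import Relation.Unary using (Pred; Decidable; _∈_; _⊆_)

-- Words and their values

-- The condition is vacuous on the empty word, which represents 0. It serves twice: for words
-- without leading zeros, and for words whose first letter lies in a given list.
data Headed {k} (P : Pred (Fin k) 0ℓ) : Word k → Set where
  []   : Headed P []
  head : ∀ {a} → P a → ∀ w → Headed P (a ∷ w)

Canonical : ∀ {k} → Word k → Set
Canonical = Headed (λ d → toℕ d ≢ 0)

headed-++ : ∀ {k} {P : Pred (Fin k) 0ℓ} {u v} →
            Headed P u → (u ≡ [] → Headed P v) → Headed P (u ++ v)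
headed-++ []          q = q refl
headed-++ (head pa w) q = head pa _

headed-prefix : ∀ {k} {P : Pred (Fin k) 0ℓ} u {v} → Headed P (u ++ v) → Headed P u
headed-prefix []      _           = []
headed-prefix (a ∷ u) (head pa _) = head pa u

module _ (k : ℕ) where

  value-foldl : ∀ m (v : Word k) →
    foldl (λ m d → m * k + toℕ d) m v ≡ m * k ^ length v + value k v
  value-foldl m []      = sym (trans (+-identityʳ _) (*-identityʳ m))
  value-foldl m (a ∷ v) = begin
    foldl (λ m d → m * k + toℕ d) (m * k + toℕ a) v        ≡⟨ value-foldl (m * k + toℕ a) v ⟩
    (m * k + toℕ a) * k ^ length v + value k v             ≡⟨ regroup m k (toℕ a) (k ^ length v) _ ⟩
    m * (k * k ^ length v) + (toℕ a * k ^ length v + value k v)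
                                                           ≡⟨ cong (m * (k * k ^ length v) +_) (value-foldl (toℕ a) v) ⟨
    m * (k * k ^ length v) + value k (a ∷ v)               ∎
    where
    open ≡-Reasoning
    regroup : ∀ m k a p v → (m * k + a) * p + v ≡ m * (k * p) + (a * p + v)
    regroup = solve-∀

  value-++ : ∀ (u v : Word k) → value k (u ++ v) ≡ value k u * k ^ length v + value k v
  value-++ u v = trans (foldl-++ _ 0 u v) (value-foldl (value k u) v)

  value-∷ : ∀ a (v : Word k) → value k (a ∷ v) ≡ toℕ a * k ^ length v + value k v
  value-∷ a v = value-foldl (toℕ a) v

  value-∷ʳ : ∀ (v : Word k) a → value k (v ∷ʳ a) ≡ value k v * k + toℕ a
  value-∷ʳ v a = foldl-++ _ 0 v _

  value< : ∀ (v : Word k) → value k v ℕ.< k ^ length v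
  value< []      = s≤s z≤n
  value< (a ∷ v) = begin-strict
    value k (a ∷ v)                      ≡⟨ value-∷ a v ⟩
    toℕ a * k ^ length v + value k v     <⟨ +-monoʳ-< (toℕ a * k ^ length v) (value< v) ⟩
    toℕ a * k ^ length v + k ^ length v  ≡⟨ +-comm _ (k ^ length v) ⟩
    suc (toℕ a) * k ^ length v           ≤⟨ *-monoˡ-≤ (k ^ length v) (Fin.toℕ<n a) ⟩
    k * k ^ length v                     ∎
    where open ≤-Reasoning

  value-∷-mono-< : ∀ {a b} (u v : Word k) → a < b → length u ≡ length v →
                   value k (a ∷ u) ℕ.< value k (b ∷ v)
  value-∷-mono-< {a} {b} u v a<b eq = begin-strict
    value k (a ∷ u)                      ≡⟨ value-∷ a u ⟩
    toℕ a * k ^ length u + value k u     <⟨ +-monoʳ-< (toℕ a * k ^ length u) (value< u) ⟩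
    toℕ a * k ^ length u + k ^ length u  ≡⟨ +-comm _ (k ^ length u) ⟩
    suc (toℕ a) * k ^ length u           ≤⟨ *-monoˡ-≤ (k ^ length u) a<b ⟩
    toℕ b * k ^ length u                 ≡⟨ cong (λ l → toℕ b * k ^ l) eq ⟩
    toℕ b * k ^ length v                 ≤⟨ m≤m+n _ _ ⟩
    toℕ b * k ^ length v + value k v     ≡⟨ value-∷ b v ⟨
    value k (b ∷ v)                      ∎
    where open ≤-Reasoning

  module _ .{{_ : NonTrivial k}} where

    private instance
      k≢0 : NonZero k
      k≢0 = nonTrivial⇒nonZero k

    canonical⇒value≢0 : ∀ {v : Word k} → Canonical v → v ≢ [] → value k v ≢ 0
    canonical⇒value≢0 []                   v≢[] = contradiction refl v≢[]
    canonical⇒value≢0 (head {a} a≢0 v) _    eq   = leading≢0 (trans (sym (value-∷ a v)) eq)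
      where
      leading≢0 : toℕ a * k ^ length v + value k v ≢ 0
      leading≢0 e with m*n≡0⇒m≡0∨n≡0 (toℕ a) (m+n≡0⇒m≡0 _ e)
      ... | inj₁ a≡0 = a≢0 a≡0
      ... | inj₂ p≡0 = contradiction p≡0 (>⇒≢ (m^n>0 k (length v)))

    value-digits′ : ∀ n (p : Acc ℕ._<_ n) → value k (digits′ k n p) ≡ n
    value-digits′ zero      _         = refl
    value-digits′ n@(suc _) (acc rec) = begin
      value k (digits′ k (n / k) _ ∷ʳ (n mod k))             ≡⟨ value-∷ʳ (digits′ k (n / k) _) (n mod k) ⟩
      value k (digits′ k (n / k) _) * k + toℕ (n mod k)      ≡⟨ cong₂ (λ q r → q * k + r) (value-digits′ (n / k) _) (Fin.toℕ-fromℕ< (m%n<n n k)) ⟩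
      n / k * k + n % k                                      ≡⟨ +-comm (n / k * k) (n % k) ⟩
      n % k + n / k * k                                      ≡⟨ m≡m%n+[m/n]*n n k ⟨
      n                                                      ∎
      where open ≡-Reasoning

    value-digits : ∀ n → value k (digits k n) ≡ n
    value-digits n = value-digits′ n (<-wellFounded n)

    canonical-digits′ : ∀ n (p : Acc ℕ._<_ n) → Canonical (digits′ k n p)
    canonical-digits′ zero      _         = []
    canonical-digits′ n@(suc _) (acc rec) =
      headed-++ (canonical-digits′ (n / k) _) (λ eq → head (lastDigit≢0 eq) [])
      where
      open ≡-Reasoning
      lastDigit≢0 : digits′ k (n / k) _ ≡ [] → toℕ (n mod k) ≢ 0
      lastDigit≢0 eq r≡0 = contradiction n≡0 λ ()
        where
        n≡0 : n ≡ 0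
        n≡0 = begin
          n                                               ≡⟨ value-digits′ n (acc rec) ⟨
          value k (digits′ k (n / k) _ ∷ʳ (n mod k))      ≡⟨ cong (λ w → value k (w ∷ʳ (n mod k))) eq ⟩
          toℕ (n mod k)                                   ≡⟨ r≡0 ⟩
          0                                               ∎

    canonical-digits : ∀ n → Canonical (digits k n)
    canonical-digits n = canonical-digits′ n (<-wellFounded n)

    ∷ʳ-value-injective : ∀ (u v : Word k) {a b} → value k (u ∷ʳ a) ≡ value k (v ∷ʳ b) →
                         value k u ≡ value k v × a ≡ b
    ∷ʳ-value-injective u v {a} {b} eq = trans (sym (quotient u a)) (trans (cong (_/ k) eq) (quotient v b))
                                      , Fin.toℕ-injective (trans (sym (remainder u a)) (trans (cong (_% k) eq) (remainder v b)))
      where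
      split : ∀ u a → value k (u ∷ʳ a) ≡ toℕ a + value k u * k
      split u a = trans (value-∷ʳ u a) (+-comm _ (toℕ a))

      remainder : ∀ u a → value k (u ∷ʳ a) % k ≡ toℕ a
      remainder u a = trans (cong (_% k) (split u a))
        (trans ([m+kn]%n≡m%n (toℕ a) (value k u) k) (m<n⇒m%n≡m (Fin.toℕ<n a)))

      quotient : ∀ u a → value k (u ∷ʳ a) / k ≡ value k u
      quotient u a = *-cancelʳ-≡ _ _ k (+-cancelˡ-≡ (toℕ a) _ _ (begin
        toℕ a + value k (u ∷ʳ a) / k * k                  ≡⟨ cong (_+ value k (u ∷ʳ a) / k * k) (remainder u a) ⟨
        value k (u ∷ʳ a) % k + value k (u ∷ʳ a) / k * k   ≡⟨ m≡m%n+[m/n]*n _ k ⟨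
        value k (u ∷ʳ a)                                  ≡⟨ split u a ⟩
        toℕ a + value k u * k                             ∎))
        where open ≡-Reasoning

    ∷ʳ≢[] : ∀ (v : Word k) {a} → v ∷ʳ a ≢ []
    ∷ʳ≢[] []      ()
    ∷ʳ≢[] (_ ∷ _) ()

    -- Induction from the right: the last digit is the remainder of the value modulo `k`, and the
    -- word before it has the quotient as its value. A nonempty canonical word cannot meet the empty
    -- one, since its value is nonzero.
    canonical-value-injective : ∀ {u v : Word k} → Canonical u → Canonical v →
                                value k u ≡ value k v → u ≡ v
    canonical-value-injective {u} {v} = go (reverseView u) (reverseView v)
      where
      go : ∀ {u v : Word k} → Reverse u → Reverse v → Canonical u → Canonical v →
           value k u ≡ value k v → u ≡ v
      go []             []             cu cv eq = refl
      go []             (v ∶ _  ∶ʳ b)  cu cv eq = contradiction (sym eq) (canonical⇒value≢0 cv (∷ʳ≢[] v))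
      go (u ∶ _  ∶ʳ a)  []             cu cv eq = contradiction eq (canonical⇒value≢0 cu (∷ʳ≢[] u))
      go (u ∶ ru ∶ʳ a)  (v ∶ rv ∶ʳ b)  cu cv eq with ∷ʳ-value-injective u v eq
      ... | eq′ , refl = cong (_∷ʳ a) (go ru rv (headed-prefix u cu) (headed-prefix v cv) eq′)

    digits-value : ∀ {v : Word k} → Canonical v → digits k (value k v) ≡ v
    digits-value {v} cv =
      canonical-value-injective (canonical-digits (value k v)) cv (value-digits (value k v))

-- IPS-sets from two interchangeable words

  module _ (x y : Word k) where

    -- The first element of the subset governs the least significant block.
    choice : ∀ {t} → Subset t → Word k
    choice []      = []
    choice (c ∷ α) = choice α ++ (if c then y else x)

    length-swap : length x ≡ length y → ∀ c (w : Word k) →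
                  length ((if c then y else x) ++ w) ≡ length x + length w
    length-swap eq false w = length-++ x
    length-swap eq true  w = trans (length-++ y) (cong (_+ length w) (sym eq))

    -- Equal lengths leave the place values of `p` unchanged, so only the exchanged block
    -- contributes, scaled by the power of `k` that `w` determines. The order of the values makes
    -- the truncated subtraction exact.
    value-swap : length x ≡ length y → value k x ≤ value k y → ∀ p w →
      value k (p ++ y ++ w) ≡ (value k y ∸ value k x) * k ^ length w + value k (p ++ x ++ w)
    value-swap eq x≤y p w = begin
      value k (p ++ y ++ w)
        ≡⟨ expand y ⟩
      value k p * k ^ length (y ++ w) + (value k y * k ^ length w + value k w)
        ≡⟨ cong₂ (λ l v → value k p * k ^ l + (v * k ^ length w + value k w))
             (trans (length-swap eq true w) (sym (length-++ x))) (sym (m∸n+n≡m x≤y)) ⟩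
      value k p * k ^ length (x ++ w) + ((value k y ∸ value k x + value k x) * k ^ length w + value k w)
        ≡⟨ regroup (value k p * k ^ length (x ++ w)) (value k y ∸ value k x) (value k x) (k ^ length w) _ ⟩
      (value k y ∸ value k x) * k ^ length w + (value k p * k ^ length (x ++ w) + (value k x * k ^ length w + value k w))
        ≡⟨ cong ((value k y ∸ value k x) * k ^ length w +_) (expand x) ⟨
      (value k y ∸ value k x) * k ^ length w + value k (p ++ x ++ w)
        ∎
      where
      open ≡-Reasoning
      expand : ∀ z → value k (p ++ z ++ w) ≡ value k p * k ^ length (z ++ w) + (value k z * k ^ length w + value k w)
      expand z = trans (value-++ p (z ++ w)) (cong (value k p * k ^ length (z ++ w) +_) (value-++ z w))
      regroup : ∀ q d x p w → q + ((d + x) * p + w) ≡ d * p + (q + (x * p + w))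
      regroup = solve-∀

    -- The induction moves the least significant block into the suffix. This lengthens `w` by one
    -- block and shifts the sequence to `n ∘ suc`, so both `w` and `n` have to vary.
    value-choice : length x ≡ length y → value k x ≤ value k y → ∀ w₀ {t} (α : Subset t) w n →
      (∀ i → n (suc i) ≡ (value k y ∸ value k x) * k ^ (i * length x + length w)) →
      value k (w₀ ++ choice α ++ w) ≡ sumOver n α + value k (w₀ ++ choice {t} ⊥ ++ w)
    value-choice eq x≤y w₀ [] w n n≡ = refl
    value-choice eq x≤y w₀ {suc t} (c ∷ α) w n n≡ = begin
      value k (w₀ ++ (choice α ++ z) ++ w)                       ≡⟨ cong (λ v → value k (w₀ ++ v)) (++-assoc (choice α) z w) ⟩
      value k (w₀ ++ choice α ++ (z ++ w))                       ≡⟨ value-choice eq x≤y w₀ α (z ++ w) (n ∘ suc) n∘suc≡ ⟩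
      sumOver (n ∘ suc) α + value k (w₀ ++ choice {t} ⊥ ++ z ++ w)    ≡⟨ cong (sumOver (n ∘ suc) α +_) (lowest c) ⟩
      sumOver (n ∘ suc) α + ((if c then n 1 else 0) + N)         ≡⟨ swap (sumOver (n ∘ suc) α) (if c then n 1 else 0) N ⟩
      (if c then n 1 else 0) + sumOver (n ∘ suc) α + N           ∎
      where
      open ≡-Reasoning
      z = if c then y else x
      N = value k (w₀ ++ choice {suc t} ⊥ ++ w)

      swap : ∀ a b c → a + (b + c) ≡ b + a + c
      swap = solve-∀

      n∘suc≡ : ∀ i → n (suc (suc i)) ≡ (value k y ∸ value k x) * k ^ (i * length x + length (z ++ w))
      n∘suc≡ i = trans (n≡ (suc i)) (cong (λ l → (value k y ∸ value k x) * k ^ l)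
        (trans (shift (length x) (i * length x) (length w)) (cong (i * length x +_) (sym (length-swap eq c w)))))
        where
        shift : ∀ a b c → a + b + c ≡ b + (a + c)
        shift = solve-∀

      ⊥-lowest : value k (w₀ ++ choice {t} ⊥ ++ x ++ w) ≡ N
      ⊥-lowest = cong (λ v → value k (w₀ ++ v)) (sym (++-assoc (choice {t} ⊥) x w))

      lowest : ∀ c → value k (w₀ ++ choice {t} ⊥ ++ (if c then y else x) ++ w) ≡ (if c then n 1 else 0) + N
      lowest false = ⊥-lowest
      lowest true  = begin
        value k (w₀ ++ choice {t} ⊥ ++ y ++ w)     ≡⟨ cong (value k) (++-assoc w₀ (choice {t} ⊥) _) ⟨
        value k ((w₀ ++ choice {t} ⊥) ++ y ++ w)   ≡⟨ value-swap eq x≤y (w₀ ++ choice {t} ⊥) w ⟩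
        (value k y ∸ value k x) * k ^ length w + value k ((w₀ ++ choice {t} ⊥) ++ x ++ w)
          ≡⟨ cong₂ _+_ (sym (n≡ 0)) (trans (cong (value k) (++-assoc w₀ (choice {t} ⊥) _)) ⊥-lowest) ⟩
        n 1 + N                                     ∎

    interchangeable⇒IPS : .{{_ : NonZero k}} → length x ≡ length y → value k x ℕ.< value k y →
      ∀ w₀ w₁ {E : Pred ℕ 0ℓ} → (∀ {t} (α : Subset t) → value k (w₀ ++ choice α ++ w₁) ∈ E) → IPS E
    interchangeable⇒IPS eq x<y w₀ w₁ {E} ∈E = n , N , n≥1 , FS⊆E
      where
      -- The indices start at 1: block `i` is followed by `i - 1` blocks and then `w₁`. The shift
      -- `N t` belongs to the empty subset, where all `t` blocks are `x`.
      n : ℕ → ℕ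
      n i = (value k y ∸ value k x) * k ^ (ℕ.pred i * length x + length w₁)

      N : ℕ → ℕ
      N t = value k (w₀ ++ choice {t} ⊥ ++ w₁)

      n≥1 : ∀ i → 1 ≤ i → 1 ≤ n i
      n≥1 i _ = *-mono-≤ (m<n⇒0<n∸m x<y) (m^n>0 k (ℕ.pred i * length x + length w₁))

      FS⊆E : FS n N ⊆ E
      FS⊆E (t , _ , α , refl) = subst E (value-choice eq (<⇒≤ x<y) w₀ α w₁ n (λ _ → refl)) (∈E α)

-- Paths in a finite automaton

[]^ʷ : ∀ {k} l → [] ^ʷ l ≡ ([] {A = Fin k})
[]^ʷ zero    = refl
[]^ʷ (suc l) = []^ʷ l

module Paths {k m : ℕ} (δ : Fin m → Fin k → Fin m) where

  infixl 6 _▷_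
  _▷_ : Fin m → Word k → Fin m
  _▷_ = foldl δ

  ▷-++ : ∀ s u v → s ▷ (u ++ v) ≡ s ▷ u ▷ v
  ▷-++ = foldl-++ δ

  ▷-loop : ∀ {s} u {v} → s ▷ u ≡ s → s ▷ v ≡ s → s ▷ (u ++ v) ≡ s
  ▷-loop {s} u {v} us vs = trans (▷-++ s u v) (trans (cong (_▷ v) us) vs)

  ▷-^ʷ : ∀ {s} u → s ▷ u ≡ s → ∀ l → s ▷ (u ^ʷ l) ≡ s
  ▷-^ʷ u us zero    = refl
  ▷-^ʷ u us (suc l) = ▷-loop u us (▷-^ʷ u us l)

  -- All states of the run count, the first and the last included. The size of `P` bounds the depth
  -- of the recursions below, which remove one state at a time.
  data Within (P : Subset m) : Fin m → Word k → Set where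
    []  : ∀ {s} → s ∈ˢ P → Within P s []
    _∷_ : ∀ {s a w} → s ∈ˢ P → Within P (δ s a) w → Within P s (a ∷ w)

  within-⊤ : ∀ s w → Within ⊤ s w
  within-⊤ s []      = [] ∈⊤
  within-⊤ s (a ∷ w) = ∈⊤ ∷ within-⊤ (δ s a) w

  within-start : ∀ {P s w} → Within P s w → s ∈ˢ P
  within-start ([] s∈P)  = s∈P
  within-start (s∈P ∷ _) = s∈P

  -- The run begins at `s`, and every later state lies in `P - s`.
  data Leaving (P : Subset m) (s : Fin m) : Word k → Set where
    []   : Leaving P s []
    step : ∀ a {w} → Within (P - s) (δ s a) w → Leaving P s (a ∷ w)

  LastVisit : Subset m → Fin m → Fin m → Word k → Set
  LastVisit P s t w = ∃[ u ] ∃[ v ] w ≡ u ++ v × t ▷ u ≡ s × Leaving P s v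

  -- A visit found in the tail is later than one at the head, so the head is compared with `s` only
  -- when the tail avoids `s`.
  lastVisit : ∀ {P} s {t w} → Within P t w → Within (P - s) t w ⊎ LastVisit P s t w
  lastVisit s {t} ([] t∈P) with t Fin.≟ s
  ... | yes refl = inj₂ ([] , [] , refl , refl , [])
  ... | no  t≢s  = inj₁ ([] (x∈p∧x≢y⇒x∈p-y t∈P t≢s))
  lastVisit s {t} (_∷_ {a = a} t∈P r) with lastVisit s r
  ... | inj₂ (u , v , eq , us , lv) = inj₂ (a ∷ u , v , cong (a ∷_) eq , us , lv)
  ... | inj₁ r′ with t Fin.≟ s
  ...   | yes refl = inj₂ ([] , _ , refl , refl , step a r′)
  ...   | no  t≢s  = inj₁ (x∈p∧x≢y⇒x∈p-y t∈P t≢s ∷ r′)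

  lastVisit-start : ∀ {P s w} → Within P s w → LastVisit P s s w
  lastVisit-start ([] _) = [] , [] , refl , refl , []
  lastVisit-start {s = s} (_∷_ {a = a} _ r) with lastVisit s r
  ... | inj₂ (u , v , eq , us , lv) = a ∷ u , v , cong (a ∷_) eq , us , lv
  ... | inj₁ r′                     = [] , _ , refl , refl , step a r′

  -- Deciding reachability by bounded search

  module _ {Q : Pred (Fin m) 0ℓ} (Q? : Decidable Q) where

    -- The index bounds the number of states on the path, one more than the number of letters; index
    -- 0 therefore allows no path.
    data ReachedIn : ℕ → Fin m → Set where
      now   : ∀ {n s} → Q s → ReachedIn (suc n) s
      later : ∀ {n s} → ∃[ a ] ReachedIn n (δ s a) → ReachedIn (suc n) s

    reachedIn? : ∀ n → Decidable (ReachedIn n)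
    reachedIn? zero    s = no λ ()
    reachedIn? (suc n) s = map′ (λ where (inj₁ q) → now q ; (inj₂ r) → later r)
                                (λ where (now q) → inj₁ q ; (later r) → inj₂ r)
                                (Q? s ⊎-dec Fin.any? (λ a → reachedIn? n (δ s a)))

    reachedIn⇒reachable : ∀ {n s} → ReachedIn n s → ∃[ w ] Q (s ▷ w)
    reachedIn⇒reachable (now q)         = [] , q
    reachedIn⇒reachable (later (a , r)) = let w , q = reachedIn⇒reachable r in a ∷ w , q

    -- Dropping everything before the last visit to `s` keeps the final state. After one more letter
    -- the run avoids `s`, so the bound drops by one along with the size of the subset.
    within⇒reachedIn : ∀ n {P s w} → ∣ P ∣ ≤ n → Within P s w → Q (s ▷ w) → ReachedIn n s
    within⇒reachedIn zero    P≤0 r q = contradiction (≤-trans (x∈p⇒∣p-x∣<∣p∣ (within-start r)) P≤0) λ ()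
    within⇒reachedIn (suc n) {s = s} P≤n r q with lastVisit-start r
    ... | u , v , refl , us , lv = go lv (subst Q (trans (▷-++ s u v) (cong (_▷ v) us)) q)
      where
      go : ∀ {v} → Leaving _ s v → Q (s ▷ v) → ReachedIn (suc n) s
      go []          q = now q
      go (step a r′) q =
        later (a , within⇒reachedIn n (ℕ.s≤s⁻¹ (≤-trans (x∈p⇒∣p-x∣<∣p∣ (within-start r)) P≤n)) r′ q)

    reachable? : Decidable (λ s → ∃[ w ] Q (s ▷ w))
    reachable? s = map′ reachedIn⇒reachable
      (λ (w , q) → within⇒reachedIn m (≤-reflexive (∣⊤∣≡n m)) (within-⊤ s w) q)
      (reachedIn? m s)

  Reach : Fin m → Fin m → Set
  Reach s t = ∃[ w ] s ▷ w ≡ t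

  reach? : ∀ s t → Dec (Reach s t)
  reach? s t = reachable? (Fin._≟ t) s

  reach-trans : ∀ {s t r} → Reach s t → Reach t r → Reach s r
  reach-trans {s} (u , refl) (v , vr) = u ++ v , trans (▷-++ s u v) vr

  -- First returns and powers of a single loop

  LoopLetter : Fin m → Fin k → Set
  LoopLetter s a = Reach (δ s a) s

  data FirstVisit (s : Fin m) : Fin m → Word k → Set where
    here : FirstVisit s s []
    step : ∀ {t a w} → t ≢ s → FirstVisit s (δ t a) w → FirstVisit s t (a ∷ w)

  firstVisit : ∀ {t s} w → t ▷ w ≡ s → ∃[ v ] FirstVisit s t v
  firstVisit {t} {s} w       eq with t Fin.≟ s
  firstVisit         w       eq | yes refl = [] , here
  firstVisit         []      eq | no t≢s   = contradiction eq t≢s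
  firstVisit         (a ∷ w) eq | no t≢s   = let v , fv = firstVisit w eq in a ∷ v , step t≢s fv

  firstVisit⇒▷ : ∀ {s t v} → FirstVisit s t v → t ▷ v ≡ s
  firstVisit⇒▷ here        = refl
  firstVisit⇒▷ (step _ fv) = firstVisit⇒▷ fv

  firstReturn? : ∀ s → Dec (∃[ a ] ∃[ v ] FirstVisit s (δ s a) v)
  firstReturn? s = map′ (map₂ λ (w , eq) → firstVisit w eq) (map₂ λ (v , fv) → v , firstVisit⇒▷ fv)
                        (Fin.any? (λ a → reach? (δ s a) s))

  -- A state on no cycle gets the empty word, whose powers are all empty, so every state has a loop
  -- that can be pumped.
  simpleLoop : Fin m → Word k
  simpleLoop s with firstReturn? s
  ... | yes (a , v , _) = a ∷ v
  ... | no  _           = []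

  ▷-simpleLoop : ∀ s → s ▷ simpleLoop s ≡ s
  ▷-simpleLoop s with firstReturn? s
  ... | yes (_ , _ , fv) = firstVisit⇒▷ fv
  ... | no  _            = refl

  -- If each state on a cycle has only one letter leading back, the first
  -- return path is a prefix of every other nonempty loop.
  module _ {U : Pred (Fin m) 0ℓ}
           (connected : ∀ {s t} → U s → Reach s t → Reach t s → U t)
           (unique : ∀ {s a b} → U s → LoopLetter s a → LoopLetter s b → a ≡ b) where

    firstVisit-prefix : ∀ {s t v} → U t → Reach s t → FirstVisit s t v →
                        ∀ p → t ▷ p ≡ s → ∃[ q ] p ≡ v ++ q × s ▷ q ≡ s
    firstVisit-prefix ut s→t here           p       ps = p , refl , ps
    firstVisit-prefix ut s→t (step t≢s fv)  []      ps = contradiction ps t≢s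
    firstVisit-prefix {t = t} {a ∷ v} ut s→t (step t≢s fv) (b ∷ p) ps
      -- Both continuations lead to `s`, and `s` leads back to `t`; hence `a` and `b` are both loop
      -- letters at `t`.
      with unique ut (reach-trans (v , firstVisit⇒▷ fv) s→t) (reach-trans (p , ps) s→t)
    ... | refl with firstVisit-prefix (connected ut (a ∷ [] , refl) (reach-trans (v , firstVisit⇒▷ fv) s→t))
                                      (reach-trans s→t (a ∷ [] , refl)) fv p ps
    ...   | q , eq , qs = q , cong (a ∷_) eq , qs

    simpleLoop-prefix : ∀ {s} → U s → ∀ b p → s ▷ (b ∷ p) ≡ s →
      ∃[ q ] b ∷ p ≡ simpleLoop s ++ q × s ▷ q ≡ s × length q ≤ length p
    simpleLoop-prefix {s} us b p ps with firstReturn? s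
    ... | no ¬r            = contradiction (b , firstVisit p ps) ¬r
    ... | yes (a , v , fv) with unique us (v , firstVisit⇒▷ fv) (p , ps)
    ...   | refl with firstVisit-prefix (connected us (a ∷ [] , refl) (v , firstVisit⇒▷ fv)) (a ∷ [] , refl) fv p ps
    ...     | q , refl , qs = q , refl , qs , length-++-≤ʳ q {v}

    -- A nonempty loop begins with the simple loop, and what remains is a strictly shorter loop.
    loop⇒power : ∀ {s} → U s → ∀ p → s ▷ p ≡ s → ∃[ l ] p ≡ simpleLoop s ^ʷ l
    loop⇒power {s} us p = go p (<-wellFounded (length p))
      where
      go : ∀ p → Acc ℕ._<_ (length p) → s ▷ p ≡ s → ∃[ l ] p ≡ simpleLoop s ^ʷ l
      go []      _         _  = 0 , refl
      go (b ∷ p) (acc rec) ps with simpleLoop-prefix us b p ps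
      ... | q , eq , qs , q≤p with go q (rec (s≤s q≤p)) qs
      ...   | l , refl = suc l , eq

-- Patterns

module _ {k : ℕ} where

  Pumps : ∀ {r} → BasicData k r → Word k → Set
  Pumps (w₀ , uw) w = ∃[ ls ] w ≡ pumped k w₀ uw ls

  Matches : ∀ {r} → List (BasicData k r) → Word k → Set
  Matches bs w = Any (λ b → Pumps b w) bs

  -- Padding with empty loops gives all patterns of a union the same rank.
  empty : ∀ r → BasicData k r
  empty r = [] , Vec.replicate r ([] , [])

  infixr 5 _◂_
  _◂_ : ∀ {r} → Fin k → BasicData k r → BasicData k r
  a ◂ (w₀ , uw) = a ∷ w₀ , uw

  star : ∀ {r} → Word k → BasicData k r → BasicData k (suc r)
  star u (w₀ , uw) = [] , (u , w₀) ∷ uw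

  pumped-empty : ∀ {r} ls → pumped k [] (Vec.replicate r ([] , [])) ls ≡ []
  pumped-empty []       = refl
  pumped-empty (l ∷ ls) = cong₂ _++_ ([]^ʷ l) (pumped-empty ls)

  pumped-∷ : ∀ a w₀ {r} (uw : Vec (Word k × Word k) r) ls →
             pumped k (a ∷ w₀) uw ls ≡ a ∷ pumped k w₀ uw ls
  pumped-∷ a w₀ []       []       = refl
  pumped-∷ a w₀ (_ ∷ _)  (_ ∷ _)  = refl

module Patterns {k m : ℕ} (δ : Fin m → Fin k → Fin m)
                {Accepting : Pred (Fin m) 0ℓ} (accepting? : Decidable Accepting) where

  open Paths δ

  emptyPatterns : ∀ r → Fin m → List (BasicData k r)
  emptyPatterns r s with accepting? s
  ... | yes _ = empty r ∷ []
  ... | no  _ = []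

  -- `patterns r s` pumps the loop at `s` and then either stops or reads one letter and continues
  -- with rank one lower. The rank bounds the number of states still to be visited. The list `ds`
  -- restricts the first letter, which matters only at the start, where leading zeros are excluded.
  patternsFrom : List (Fin k) → ∀ r → Fin m → List (BasicData k r)
  patterns     : ∀ r → Fin m → List (BasicData k r)

  patternsFrom ds r s = emptyPatterns r s ++ concatMap (λ a → map (a ◂_) (patterns r (δ s a))) ds

  patterns zero    s = []
  patterns (suc r) s = map (star (simpleLoop s)) (patternsFrom (allFin k) r s)

  emptyPatterns-sound : ∀ r s {w} → Matches (emptyPatterns r s) w → w ≡ [] × Accepting s
  emptyPatterns-sound r s p with accepting? s
  emptyPatterns-sound r s (here (ls , refl)) | yes acc-s = pumped-empty ls , acc-s

  emptyPatterns-complete : ∀ r {s} → Accepting s → Matches (emptyPatterns r s) []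
  emptyPatterns-complete r {s} acc-s with accepting? s
  ... | yes _    = here (Vec.replicate r 0 , sym (pumped-empty (Vec.replicate r 0)))
  ... | no ¬acc = contradiction acc-s ¬acc

  -- Powers of a loop at `s` do not change the state reached from `s`, so a pumped word ends where
  -- its unpumped remainder does.
  patternsFrom-sound : ∀ ds r s {w} → Matches (patternsFrom ds r s) w →
                       Headed (_∈ˡ ds) w × Accepting (s ▷ w)
  patterns-sound     : ∀ r s {w} → Matches (patterns r s) w → Accepting (s ▷ w)

  patternsFrom-sound ds r s p with ++⁻ (emptyPatterns r s) p
  ... | inj₁ p₁ with emptyPatterns-sound r s p₁
  ...   | refl , acc-s = [] , acc-s
  patternsFrom-sound ds r s p | inj₂ p₂ with find (concatMap⁻ (λ a → map (a ◂_) (patterns r (δ s a))) {xs = ds} p₂)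
  ... | a , a∈ds , q with find (map⁻ q)
  ...   | (w₀ , uw) , b∈ , ls , refl rewrite pumped-∷ a w₀ uw ls =
    head a∈ds _ , patterns-sound r (δ s a) (lose b∈ (ls , refl))

  patterns-sound (suc r) s p with find (map⁻ p)
  ... | (w₀ , uw) , b∈ , l ∷ ls , refl = subst Accepting (sym s▷)
    (proj₂ (patternsFrom-sound (allFin k) r s (lose b∈ (ls , refl))))
    where
    s▷ : s ▷ (simpleLoop s ^ʷ l ++ pumped k w₀ uw ls) ≡ s ▷ pumped k w₀ uw ls
    s▷ = trans (▷-++ s (simpleLoop s ^ʷ l) _)
               (cong (_▷ pumped k w₀ uw ls) (▷-^ʷ (simpleLoop s) (▷-simpleLoop s) l))

  ◂-matches : ∀ a {r} {bs : List (BasicData k r)} {w} → Matches bs w → Matches (map (a ◂_) bs) (a ∷ w)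
  ◂-matches a = map⁺ ∘ Any.map λ { {w₀ , uw} (ls , eq) → ls , trans (cong (a ∷_) eq) (sym (pumped-∷ a w₀ uw ls)) }

  star-matches : ∀ u l {r} {bs : List (BasicData k r)} {w} → Matches bs w →
                 Matches (map (star u) bs) (u ^ʷ l ++ w)
  star-matches u l = map⁺ ∘ Any.map λ (ls , eq) → l ∷ ls , cong (u ^ʷ l ++_) eq

  patternsFrom-[] : ∀ ds r {s} → Accepting s → Matches (patternsFrom ds r s) []
  patternsFrom-[] ds r acc-s = ++⁺ˡ (emptyPatterns-complete r acc-s)

  patternsFrom-∷ : ∀ {ds} r {s a w} → a ∈ˡ ds → Matches (patterns r (δ s a)) w →
                   Matches (patternsFrom ds r s) (a ∷ w)
  patternsFrom-∷ r {s} {a} a∈ds p =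
    ++⁺ʳ (emptyPatterns r s) (concatMap⁺ _ (lose a∈ds (◂-matches a p)))

  -- Completeness of the patterns when loop letters are unique

  module _ {A : Pred (Fin m) 0ℓ}
           (closed : ∀ {s} → A s → ∀ a → A (δ s a))
           (unique : ∀ {s a b} → A s → ∃[ w ] Accepting (s ▷ w) →
                     LoopLetter s a → LoopLetter s b → a ≡ b) where

    closed* : ∀ {s} → A s → ∀ w → A (s ▷ w)
    closed* as []      = as
    closed* as (a ∷ w) = closed* (closed as a) w

    Useful : Pred (Fin m) 0ℓ
    Useful s = A s × ∃[ w ] Accepting (s ▷ w)

    -- An accepting word for `t` is a path back to `s` followed by an accepting word for `s`.
    useful-connected : ∀ {s t} → Useful s → Reach s t → Reach t s → Useful t
    useful-connected {s} {t} (as , w , acc-w) (u , refl) (v , vs) =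
      closed* as u , v ++ w , subst Accepting (sym (trans (▷-++ t v w) (cong (_▷ w) vs))) acc-w

    -- Up to the last visit to `s` the word is a loop, hence a power of the simple loop. The rest is
    -- empty or one letter followed by a run in `P - s`, which the induction covers.
    patterns-complete : ∀ r {P s w} → A s → ∣ P ∣ ≤ r → Within P s w → Accepting (s ▷ w) →
                        Matches (patterns r s) w
    patterns-complete zero    as P≤0 ρ acc-w =
      contradiction (≤-trans (x∈p⇒∣p-x∣<∣p∣ (within-start ρ)) P≤0) λ ()
    patterns-complete (suc r) {P} {s} {w} as P≤r ρ acc-w with lastVisit-start ρ
    ... | u , v , refl , us , lv
      with loop⇒power useful-connected (λ (as , co) → unique as co) (as , w , acc-w) u us
    ...   | l , refl = star-matches (simpleLoop s) l (rest lv (subst Accepting s▷ acc-w))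
      where
      s▷ : s ▷ (u ++ v) ≡ s ▷ v
      s▷ = trans (▷-++ s u v) (cong (_▷ v) us)

      rest : ∀ {v} → Leaving P s v → Accepting (s ▷ v) → Matches (patternsFrom (allFin k) r s) v
      rest []          acc-v = patternsFrom-[] (allFin k) r acc-v
      rest (step a ρ′) acc-v = patternsFrom-∷ r (∈-allFin a)
        (patterns-complete r (closed as a) (ℕ.s≤s⁻¹ (≤-trans (x∈p⇒∣p-x∣<∣p∣ (within-start ρ)) P≤r)) ρ′ acc-v)

-- The dichotomy: branching states or unique loops

module Dichotomy (k : ℕ) .{{_ : NonTrivial k}} {m : ℕ} (start : Fin m) (δ : Fin m → Fin k → Fin m)
                 {Accepting : Pred (Fin m) 0ℓ} (accepting? : Decidable Accepting) where

  open Paths δ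
  open Patterns δ accepting?

  private instance
    k≢0 : NonZero k
    k≢0 = nonTrivial⇒nonZero k

  Accepted : Pred ℕ 0ℓ
  Accepted n = Accepting (start ▷ digits k n)

  accepted-value : ∀ {w} → Canonical w → Accepting (start ▷ w) → value k w ∈ Accepted
  accepted-value cw = subst (λ w → Accepting (start ▷ w)) (sym (digits-value k cw))

  NonzeroDigit : Pred (Fin k) 0ℓ
  NonzeroDigit d = toℕ d ≢ 0

  nonzeroDigit? : Decidable NonzeroDigit
  nonzeroDigit? d = ¬? (toℕ d ℕ.≟ 0)

  -- Reached by a nonempty word without leading zero: the automaton is only ever run on canonical
  -- expansions.
  Accessible : Pred (Fin m) 0ℓ
  Accessible s = ∃[ d ] NonzeroDigit d × Reach (δ start d) s

  Branching : Pred (Fin m) 0ℓ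
  Branching s = Accessible s × (∃[ w ] Accepting (s ▷ w)) ×
                ∃[ a ] ∃[ b ] a < b × LoopLetter s a × LoopLetter s b

  branching? : Decidable Branching
  branching? s =
    Fin.any? (λ d → nonzeroDigit? d ×-dec reach? (δ start d) s) ×-dec
    reachable? accepting? s ×-dec
    Fin.any? (λ a → Fin.any? (λ b → a Fin.<? b ×-dec reach? (δ s a) s ×-dec reach? (δ s b) s))

  ▷-choice : ∀ {s} x y → s ▷ x ≡ s → s ▷ y ≡ s → ∀ {t} (α : Subset t) → s ▷ choice k x y α ≡ s
  ▷-choice x y xs ys []          = refl
  ▷-choice x y xs ys (false ∷ α) = ▷-loop (choice k x y α) (▷-choice x y xs ys α) xs
  ▷-choice x y xs ys (true  ∷ α) = ▷-loop (choice k x y α) (▷-choice x y xs ys α) ys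

  branching⇒IPS : ∃ Branching → IPS Accepted
  branching⇒IPS (s , (d , d≢0 , v , refl) , (w₁ , acc-w₁) , a , b , a<b , (p , ps) , (q , qs)) =
    interchangeable⇒IPS k x y lengths≡ (value-∷-mono-< k (p ++ b ∷ q) (q ++ a ∷ p) a<b (suc-injective lengths≡))
      (d ∷ v) w₁ λ α → accepted-value (head d≢0 (v ++ choice k x y α ++ w₁)) (subst Accepting (sym (run α)) acc-w₁)
    where
    -- The two loops at `s` in either order: equal lengths, and `a < b` at the first letter makes
    -- the value of `x` the smaller one. The prefix `d ∷ v` with `d` nonzero keeps every combination
    -- canonical.
    x = (a ∷ p) ++ (b ∷ q)
    y = (b ∷ q) ++ (a ∷ p)

    lengths≡ : length x ≡ length y
    lengths≡ = length-++-comm (a ∷ p) (b ∷ q)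

    run : ∀ {t} (α : Subset t) → start ▷ ((d ∷ v) ++ choice k x y α ++ w₁) ≡ s ▷ w₁
    run α = trans (▷-++ start (d ∷ v) _) (trans (▷-++ s (choice k x y α) w₁)
      (cong (_▷ w₁) (▷-choice x y (▷-loop (a ∷ p) ps qs) (▷-loop (b ∷ q) qs ps) α)))

  unbranched⇒unique : ¬ ∃ Branching → ∀ {s a b} → Accessible s → ∃[ w ] Accepting (s ▷ w) →
                      LoopLetter s a → LoopLetter s b → a ≡ b
  unbranched⇒unique ¬br {s} {a} {b} ac co la lb with Fin.<-cmp a b
  ... | tri< a<b _ _ = contradiction (s , ac , co , a , b , a<b , la , lb) ¬br
  ... | tri≈ _ a≡b _ = a≡b
  ... | tri> _ _ b<a = contradiction (s , ac , co , b , a , b<a , lb , la) ¬br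

  unbranched⇒verySparse : ¬ ∃ Branching → VerySparseSet k m Accepted
  unbranched⇒verySparse ¬br = bs , complete , sound
    where
    ds : List (Fin k)
    ds = filter nonzeroDigit? (allFin k)

    -- The first letter is read outside every pumped loop, so requiring it to be nonzero makes all
    -- matched words canonical. Rank `m` suffices for the run after it, which visits at most `m`
    -- distinct states.
    bs : List (BasicData k m)
    bs = patternsFrom ds m start

    closed : ∀ {s} → Accessible s → ∀ a → Accessible (δ s a)
    closed (d , d≢0 , r) a = d , d≢0 , reach-trans r (a ∷ [] , refl)

    matched : ∀ {w} → Canonical w → Accepting (start ▷ w) → Matches bs w
    matched []             acc-w = patternsFrom-[] ds m acc-w
    matched (head {a} a≢0 w) acc-w = patternsFrom-∷ m (∈-filter⁺ nonzeroDigit? (∈-allFin a) a≢0)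
      (patterns-complete closed (unbranched⇒unique ¬br) m (a , a≢0 , [] , refl)
        (≤-reflexive (∣⊤∣≡n m)) (within-⊤ (δ start a) w) acc-w)

    complete : ∀ {n} → n ∈ Accepted → Any (λ b → n ∈ BasicVerySparse k b) bs
    complete {n} acc-n = Any.map (λ (ls , eq) → ls , trans (sym (value-digits k n)) (cong (value k) eq))
                                 (matched (canonical-digits k n) acc-n)

    canonical : ∀ {w} → Headed (_∈ˡ ds) w → Canonical w
    canonical []            = []
    canonical (head a∈ds w) = head (proj₂ (∈-filter⁻ nonzeroDigit? {xs = allFin k} a∈ds)) w

    sound : ∀ {n} → Any (λ b → n ∈ BasicVerySparse k b) bs → n ∈ Accepted
    sound p with find p
    ... | b , b∈bs , ls , refl with patternsFrom-sound ds m start (lose b∈bs (ls , refl))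
    ...   | hw , acc-w = accepted-value (canonical hw) acc-w

-- Transfer to an arbitrary finite automaton

theorem3p13 : (k : ℕ) .{{_ : NonTrivial k}} (f : ℕ → Fin 2) →
    Sparse f → Automatic k f →
    VerySparse k f ⊎ (Σ[ E ∈ Pred ℕ 0ℓ ] (IPS E × (∀ n → n ∈ E → f n ≡ 1F)))
theorem3p13 k f _ (A , f≡) = case Fin.any? branching? of λ where
    -- The finite sums lie in the support of `f`, so the whole support serves as the IPS-set.
    (yes br) → let n , N , n≥1 , ⊆Accepted = branching⇒IPS br in
               inj₂ (Support f , (n , N , n≥1 , λ {n} e → accepted⇒support {n} (⊆Accepted e)) , λ _ → id)
    (no ¬br) → let bs , complete , sound = unbranched⇒verySparse ¬br in
               inj₁ (m , bs , (λ {n} e → complete (support⇒accepted {n} e)) , λ {n} e → accepted⇒support {n} (sound e))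
  where
  open Automaton A
  open ≡-Reasoning

  m = proj₁ state-finite
  open Inverse (proj₂ state-finite)

  -- The automaton is carried along the bijection of its states with `Fin m`, where states can be
  -- compared, searched and collected in subsets.
  δ′ : Fin m → Fin k → Fin m
  δ′ i a = to (δ (from i) a)

  open Dichotomy k (to start) δ′ (λ i → τ (from i) Fin.≟ 1F)

  foldl-δ′ : ∀ s w → foldl δ′ (to s) w ≡ to (foldl δ s w)
  foldl-δ′ s []      = refl
  foldl-δ′ s (a ∷ w) = trans (cong (λ t → foldl δ′ (to (δ t a)) w) (strictlyInverseʳ s)) (foldl-δ′ (δ s a) w)

  f≡′ : ∀ n → f n ≡ τ (from (foldl δ′ (to start) (digits k n)))
  f≡′ n = begin
    f n                                              ≡⟨ f≡ n ⟩
    τ (δ̃ start (digits k n))                         ≡⟨ cong τ (strictlyInverseʳ _) ⟨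
    τ (from (to (δ̃ start (digits k n))))             ≡⟨ cong (τ ∘ from) (foldl-δ′ start (digits k n)) ⟨
    τ (from (foldl δ′ (to start) (digits k n)))      ∎

  support⇒accepted : Support f ⊆ Accepted
  support⇒accepted {n} = trans (sym (f≡′ n))

  accepted⇒support : Accepted ⊆ Support f
  accepted⇒support {n} = trans (f≡′ n)
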